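{- (Fundamental Theorem of Logical Relation.) Let $(\mathsf{J}\mathbb{N},\eta,\kappa)$ be a nucleus relative to System $\mathsf{T}$. Let ${\mathrel{R}_{\mathbb{N}}} \subseteq \mathbb{N} \times \mathsf{J}\mathbb{N}$ be a binary relation, and extend it to relations ${\mathrel{R}_{\rho}} \subseteq \rho \times \rho^\mathsf{J}$ for every type $\rho$ of $\mathsf{T}$ by \[ f \mathrel{R}_{\sigma\to\tau} g \;:\Longleftrightarrow\; \forall x^{\sigma}\, a^{\sigma^\mathsf{J}} \left( x \mathrel{R}_{\sigma} a \to fx \mathrel{R}_{\tau} ga \right). \] Suppose that \[ \forall n^\mathbb{N} \left( n \mathrel{R}_{\mathbb{N}} \eta n \right) \qquad\text{and}\qquad \forall f^{\mathbb{N}\to\mathbb{N}}\, g^{\mathbb{N}\to\mathsf{J}\mathbb{N}} \left( \forall n^\mathbb{N} \left(fn \mathrel{R}_{\mathbb{N}} gn\right) \to f \mathrel{R}_{\mathbb{N}\to\mathbb{N}} \kappa g \right). \] Then $t \mathrel{R}_\rho t^\mathsf{J}$ for every closed term $t:\rho$ of $\mathsf{T}$.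
   Context: Gödel's System $\mathsf{T}$: types are generated by $\sigma,\tau ::= \mathbb{N} \mid \sigma\to\tau$; terms by $t,u ::= x \mid \lambda x^\sigma.t \mid tu \mid 0 \mid \mathsf{suc} \mid \mathsf{rec}_\sigma$, with the usual simply-typed typing rules, $0:\mathbb{N}$, $\mathsf{suc}:\mathbb{N}\to\mathbb{N}$, $\mathsf{rec}_\sigma : \sigma \to (\mathbb{N}\to\sigma\to\sigma)\to\mathbb{N}\to\sigma$, and computation rules $\mathsf{rec}_\sigma(a,f,0)=a$, $\mathsf{rec}_\sigma(a,f,\mathsf{suc}\,n)=f(n,\mathsf{rec}_\sigma(a,f,n))$. We write $f(a_1,\dots,a_n)$ for iterated application and $f\circ g$ for $\lambda x.f(gx)$. Objects of a type are its (standard) interpretations/values; quantifiers $\forall x^\sigma$ range over objects of type $\sigma$. A nucleus relative to $\mathsf{T}$ is a triple $(\mathsf{J}\mathbb{N},\eta,\kappa)$ of a type $\mathsf{J}\mathbb{N}$ of $\mathsf{T}$ and two terms $\eta:\mathbb{N}\to\mathsf{J}\mathbb{N}$, $\kappa:(\mathbb{N}\to\mathsf{J}\mathbb{N})\to\mathsf{J}\mathbb{N}\to\mathsf{J}\mathbb{N}$ of $\mathsf{T}$ (no monad laws are required). The $\mathsf{J}$-translation: on types, $\mathbb{N}^\mathsf{J}:=\mathsf{J}\mathbb{N}$ and $(\sigma\to\tau)^\mathsf{J}:=\sigma^\mathsf{J}\to\tau^\mathsf{J}$. A term $\Gamma\vdash t:\rho$ is translated to $\Gamma^\mathsf{J}\vdash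 t^\mathsf{J}:\rho^\mathsf{J}$, where each variable $x:\sigma$ of $\Gamma$ is replaced by a fresh $x^\mathsf{J}:\sigma^\mathsf{J}$, and: $(x)^\mathsf{J}:=x^\mathsf{J}$; $(\lambda x.t)^\mathsf{J}:=\lambda x^\mathsf{J}.t^\mathsf{J}$; $(tu)^\mathsf{J}:=t^\mathsf{J}u^\mathsf{J}$; $0^\mathsf{J}:=\eta\,0$; $\mathsf{suc}^\mathsf{J}:=\kappa(\eta\circ\mathsf{suc})$; $(\mathsf{rec}_\sigma)^\mathsf{J}:=\lambda x^{\sigma^\mathsf{J}} f^{\mathsf{J}\mathbb{N}\to\sigma^\mathsf{J}\to\sigma^\mathsf{J}}.\,\mathrm{ke}_\sigma(\mathsf{rec}_{\sigma^\mathsf{J}}(x,f\circ\eta))$, where $\mathrm{ke}_\sigma:(\mathbb{N}\to\sigma^\mathsf{J})\to\mathsf{J}\mathbb{N}\to\sigma^\mathsf{J}$ is defined by induction on $\sigma$: $\mathrm{ke}_\mathbb{N}:=\kappa$ and $\mathrm{ke}_{\sigma\to\tau}:=\lambda g^{\mathbb{N}\to\sigma^\mathsf{J}\to\tau^\mathsf{J}} a^{\mathsf{J}\mathbb{N}} x^{\sigma^\mathsf{J}}.\,\mathrm{ke}_\tau(\lambda n^\mathbb{N}.g(n,x),a)$. -}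

module Defs where

open import Data.Nat using (ℕ; zero; suc)
open import Data.List using (List; []; _∷_)

infixr 7 _⇒_

data Ty : Set where
  nat : Ty
  _⇒_ : Ty → Ty → Ty

Ctx : Set
Ctx = List Ty

data _∋_ : Ctx → Ty → Set where
  here  : ∀ {Γ σ} → (σ ∷ Γ) ∋ σ
  there : ∀ {Γ σ τ} → Γ ∋ σ → (τ ∷ Γ) ∋ σ

data Tm (Γ : Ctx) : Ty → Set where
  var  : ∀ {σ} → Γ ∋ σ → Tm Γ σ
  lam  : ∀ {σ τ} → Tm (σ ∷ Γ) τ → Tm Γ (σ ⇒ τ)
  app  : ∀ {σ τ} → Tm Γ (σ ⇒ τ) → Tm Γ σ → Tm Γ τ
  zeroT : Tm Γ nat
  sucT  : Tm Γ (nat ⇒ nat)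
  recT  : (σ : Ty) → Tm Γ (σ ⇒ (nat ⇒ σ ⇒ σ) ⇒ nat ⇒ σ)

Ren : Ctx → Ctx → Set
Ren Γ Δ = ∀ {σ} → Γ ∋ σ → Δ ∋ σ

ext : ∀ {Γ Δ τ} → Ren Γ Δ → Ren (τ ∷ Γ) (τ ∷ Δ)
ext r here      = here
ext r (there x) = there (r x)

rename : ∀ {Γ Δ σ} → Ren Γ Δ → Tm Γ σ → Tm Δ σ
rename r (var x)   = var (r x)
rename r (lam t)   = lam (rename (ext r) t)
rename r (app t u) = app (rename r t) (rename r u)
rename r zeroT     = zeroT
rename r sucT      = sucT
rename r (recT σ)  = recT σ

wk : ∀ {Γ σ} → Tm [] σ → Tm Γ σ
wk = rename (λ ())

⟦_⟧ : Ty → Set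
⟦ nat ⟧   = ℕ
⟦ σ ⇒ τ ⟧ = ⟦ σ ⟧ → ⟦ τ ⟧

Env : Ctx → Set
Env Γ = ∀ {σ} → Γ ∋ σ → ⟦ σ ⟧

emptyEnv : Env []
emptyEnv ()

_∷ₑ_ : ∀ {Γ σ} → ⟦ σ ⟧ → Env Γ → Env (σ ∷ Γ)
(v ∷ₑ ρ) here      = v
(v ∷ₑ ρ) (there x) = ρ x

recℕ : {A : Set} → A → (ℕ → A → A) → ℕ → A
recℕ a f zero    = a
recℕ a f (suc n) = f n (recℕ a f n)

eval : ∀ {Γ σ} → Tm Γ σ → Env Γ → ⟦ σ ⟧
eval (var x)   ρ = ρ x
eval (lam t)   ρ = λ v → eval t (v ∷ₑ ρ)
eval (app t u) ρ = eval t ρ (eval u ρ)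
eval zeroT     ρ = zero
eval sucT      ρ = suc
eval (recT σ)  ρ = recℕ

⟦_⟧₀ : ∀ {σ} → Tm [] σ → ⟦ σ ⟧
⟦ t ⟧₀ = eval t emptyEnv

-- Nucleus relative to T (no monad laws)

record Nucleus : Set where
  field
    JN : Ty
    η  : Tm [] (nat ⇒ JN)
    κ  : Tm [] ((nat ⇒ JN) ⇒ JN ⇒ JN)

module Translation (N : Nucleus) where
  open Nucleus N

  tyJ : Ty → Ty
  tyJ nat     = JN
  tyJ (σ ⇒ τ) = tyJ σ ⇒ tyJ τ

  ctxJ : Ctx → Ctx
  ctxJ []      = []
  ctxJ (σ ∷ Γ) = tyJ σ ∷ ctxJ Γ

  varJ : ∀ {Γ σ} → Γ ∋ σ → ctxJ Γ ∋ tyJ σ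
  varJ here      = here
  varJ (there x) = there (varJ x)

  ke : (σ : Ty) → Tm [] ((nat ⇒ tyJ σ) ⇒ JN ⇒ tyJ σ)
  ke nat     = κ
  ke (σ ⇒ τ) =
    lam (lam (lam                              -- g, a, x
      (app (app (wk (ke τ))
                (lam (app (app (var (there (there (there here)))) (var here))
                          (var (there here)))))   -- λ n. g n x
           (var (there here)))))                  -- a

  -- rec_σ ᴶ := λ x f. ke_σ (rec_{σᴶ} (x , f ∘ η))
  recJ : ∀ {Γ} (σ : Ty) →
         Tm Γ (tyJ σ ⇒ (JN ⇒ tyJ σ ⇒ tyJ σ) ⇒ JN ⇒ tyJ σ)
  recJ σ =
    lam (lam                                     -- x, f
      (app (wk (ke σ))
           (app (app (recT (tyJ σ)) (var (there here)))
                (lam (app (var (there here)) (app (wk η) (var here)))))))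

  tmJ : ∀ {Γ σ} → Tm Γ σ → Tm (ctxJ Γ) (tyJ σ)
  tmJ (var x)   = var (varJ x)
  tmJ (lam t)   = lam (tmJ t)
  tmJ (app t u) = app (tmJ t) (tmJ u)
  tmJ zeroT     = app (wk η) zeroT
  tmJ sucT      = app (wk κ) (lam (app (wk η) (app sucT (var here))))
  tmJ (recT σ)  = recJ σ

  LR : (⟦ nat ⟧ → ⟦ JN ⟧ → Set) → (ρ : Ty) → ⟦ ρ ⟧ → ⟦ tyJ ρ ⟧ → Set
  LR Rℕ nat     n a = Rℕ n a
  LR Rℕ (σ ⇒ τ) f g = ∀ (x : ⟦ σ ⟧) (a : ⟦ tyJ σ ⟧) →
                        LR Rℕ σ x a → LR Rℕ τ (f x) (g a)

{-# OPTIONS --safe #-}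

-- Induction on terms, with environments related pointwise; the recursor is the
-- only case with content, and reduces to κ because ke preserves the relation.
-- The delicate point is that Rℕ need not respect pointwise equality when JN is
-- a function type, so that ⟦ wk t ⟧ and ⟦ t ⟧ must be identified up to _≡_
-- without function extensionality. This works for denotations taken as whole
-- functions of a tuple of values: every step under a binder is then a
-- congruence.

module Submission where

open import Defs
open import Data.Nat using (ℕ; zero; suc)
open import Data.List using ([]; _∷_)
open import Data.Product using (_×_; _,_; proj₂)
open import Data.Unit using (⊤; tt)
open import Relation.Binary.PropositionalEquality
  using (_≡_; refl; sym; trans; cong; cong₂; cong-app; subst)

Tuple : Ctx → Set
Tuple []      = ⊤
Tuple (σ ∷ Γ) = ⟦ σ ⟧ × Tuple Γ

-- By recursion on the context rather than by lookup, so that extending a tuple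
-- is definitionally _∷ₑ_.
toEnv : ∀ {Γ} → Tuple Γ → Env Γ
toEnv {[]}    _       = emptyEnv
toEnv {σ ∷ Γ} (v , ρ) = v ∷ₑ toEnv ρ

evalTuple : ∀ {Γ σ} → Tm Γ σ → Tuple Γ → ⟦ σ ⟧
evalTuple t ρ = eval t (toEnv ρ)

renTuple : ∀ {Γ Δ} → Ren Γ Δ → Tuple Δ → Tuple Γ
renTuple {[]}    r ρ = tt
renTuple {σ ∷ Γ} r ρ = toEnv ρ (r here) , renTuple (λ x → r (there x)) ρ

-- Equates whole functions so that it can be rewritten under the binder `v` in the `lam` case below.
renTuple-there : ∀ {Γ Δ τ} (r : Ren Γ Δ) →
  renTuple {Δ = τ ∷ Δ} (λ x → there (r x)) ≡ (λ ρ → renTuple r (proj₂ ρ))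
renTuple-there {[]}    r = refl
renTuple-there {σ ∷ Γ} r =
  cong (λ F ρ → toEnv (proj₂ ρ) (r here) , F ρ) (renTuple-there (λ x → r (there x)))

toEnv-renTuple : ∀ {Γ Δ σ} (r : Ren Γ Δ) (x : Γ ∋ σ) →
  (λ (ρ : Tuple Δ) → toEnv ρ (r x)) ≡ (λ ρ → toEnv (renTuple r ρ) x)
toEnv-renTuple r here      = refl
toEnv-renTuple r (there x) = toEnv-renTuple (λ y → r (there y)) x

evalTuple-rename : ∀ {Γ Δ σ} (r : Ren Γ Δ) (t : Tm Γ σ) →
  evalTuple (rename r t) ≡ (λ ρ → evalTuple t (renTuple r ρ))
evalTuple-rename r (var x)   = toEnv-renTuple r x
evalTuple-rename r (lam t)   = trans
  (cong (λ F ρ v → F (v , ρ)) (evalTuple-rename (ext r) t))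
  -- Renaming `(v , ρ)` along `ext r` keeps `v` definitionally, so only the tail needs rewriting.
  (cong (λ F ρ v → evalTuple t (v , F (v , ρ))) (renTuple-there r))
evalTuple-rename r (app t u) =
  cong₂ (λ F G ρ → F ρ (G ρ)) (evalTuple-rename r t) (evalTuple-rename r u)
evalTuple-rename r zeroT     = refl
evalTuple-rename r sucT      = refl
evalTuple-rename r (recT σ)  = refl

-- A tuple renamed to the empty context is `tt`, where `t` evaluates to `⟦ t ⟧₀`.
wk-intro : ∀ {Γ σ} (P : ⟦ σ ⟧ → Set) (t : Tm [] σ) (ρ : Tuple Γ) →
  P ⟦ t ⟧₀ → P (evalTuple (wk t) ρ)
wk-intro P t ρ = subst P (sym (cong-app (evalTuple-rename (λ ()) t) ρ))

module _ (N : Nucleus) (Rℕ : ℕ → ⟦ Nucleus.JN N ⟧ → Set) where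
  open Nucleus N
  open Translation N

  _∼_ : ∀ {Γ} → Tuple Γ → Tuple (ctxJ Γ) → Set
  _∼_ {Γ} ρ ρᴶ = ∀ {σ} (x : Γ ∋ σ) → LR Rℕ σ (toEnv ρ x) (toEnv ρᴶ (varJ x))

  ∼-cons : ∀ {Γ σ v vᴶ} {ρ : Tuple Γ} {ρᴶ : Tuple (ctxJ Γ)} →
    LR Rℕ σ v vᴶ → ρ ∼ ρᴶ → _∼_ {σ ∷ Γ} (v , ρ) (vᴶ , ρᴶ)
  ∼-cons v∼ ρ∼ here      = v∼
  ∼-cons v∼ ρ∼ (there x) = ρ∼ x

  -- The hypothesis on `κ`, generalised from `nat` to every type to allow induction along `ke`.
  Extends : ∀ σ → ((ℕ → ⟦ tyJ σ ⟧) → ⟦ JN ⟧ → ⟦ tyJ σ ⟧) → Set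
  Extends σ h = ∀ f g → (∀ n → LR Rℕ σ (f n) (g n)) → LR Rℕ (nat ⇒ σ) f (h g)

  module _ (R-η : ∀ n → Rℕ n (⟦ η ⟧₀ n)) (R-κ : Extends nat ⟦ κ ⟧₀) where

    R-wk-η : ∀ {Γ} (ρ : Tuple Γ) n → Rℕ n (evalTuple (wk η) ρ n)
    R-wk-η ρ = wk-intro (λ h → ∀ n → Rℕ n (h n)) η ρ R-η

    ke-extends : ∀ σ → Extends σ ⟦ ke σ ⟧₀
    ke-extends nat     = R-κ
    ke-extends (σ ⇒ τ) f g f∼g n a n∼a x b x∼b =
      -- The tuple is the environment under the three binders of `ke (σ ⇒ τ)`; fixing the related
      -- pair `x`, `b` leaves a problem at `τ`.
      wk-intro (Extends τ) (ke τ) (b , a , g , tt) (ke-extends τ)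
        (λ m → f m x) (λ m → g m b) (λ m → f∼g m x b x∼b) n a n∼a

    fundamental : ∀ {Γ σ} (t : Tm Γ σ) (ρ : Tuple Γ) (ρᴶ : Tuple (ctxJ Γ)) →
      ρ ∼ ρᴶ → LR Rℕ σ (evalTuple t ρ) (evalTuple (tmJ t) ρᴶ)
    fundamental (var x) ρ ρᴶ ρ∼ = ρ∼ x
    fundamental (lam t) ρ ρᴶ ρ∼ v vᴶ v∼ =
      fundamental t (v , ρ) (vᴶ , ρᴶ) (∼-cons {ρ = ρ} {ρᴶ} v∼ ρ∼)
    fundamental (app t u) ρ ρᴶ ρ∼ =
      fundamental t ρ ρᴶ ρ∼ _ _ (fundamental u ρ ρᴶ ρ∼)
    fundamental zeroT ρ ρᴶ ρ∼ = R-wk-η ρᴶ zero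
    fundamental sucT ρ ρᴶ ρ∼ =
      wk-intro (Extends nat) κ ρᴶ R-κ suc _ (λ n → R-wk-η (n , ρᴶ) (suc n))
    fundamental (recT σ) ρ ρᴶ ρ∼ x a x∼a f g f∼g =
      -- Both recursions run over numerals in `rec∼`; `ke-extends` passes to arguments in `JN`.
      wk-intro (Extends σ) (ke σ) (g , a , ρᴶ) (ke-extends σ) (recℕ x f) _ rec∼
      where
      rec∼ : ∀ n → LR Rℕ σ (recℕ x f n)
        (recℕ a (λ m → g (evalTuple (wk η) (m , g , a , ρᴶ) m)) n)
      rec∼ zero    = x∼a
      -- The translated step receives `η n` in place of `n`.
      rec∼ (suc n) = f∼g n _ (R-wk-η (n , g , a , ρᴶ) n) _ _ (rec∼ n)

theorem3 : (N : Nucleus) → (Rℕ : ℕ → ⟦ Nucleus.JN N ⟧ → Set) →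
    (∀ (n : ℕ) → Rℕ n (⟦ Nucleus.η N ⟧₀ n)) →
    (∀ (f : ℕ → ℕ) (g : ℕ → ⟦ Nucleus.JN N ⟧) →
      (∀ (n : ℕ) → Rℕ (f n) (g n)) →
      Translation.LR N Rℕ (nat ⇒ nat) f (⟦ Nucleus.κ N ⟧₀ g)) →
    ∀ (ρ : Ty) (t : Tm [] ρ) → Translation.LR N Rℕ ρ ⟦ t ⟧₀ ⟦ Translation.tmJ N t ⟧₀
theorem3 N Rℕ R-η R-κ ρ t = fundamental N Rℕ R-η R-κ t tt tt (λ ())
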